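{- Let $k$ be an algebraically closed field, let $P$ be a finite poset, and let $I(P)$ be the incidence algebra of $P$ over $k$, regarded as an algebraic monoid (an affine space with its multiplication). Then the group $\mathrm{Aut}_{s.g.}(I(P))$ of algebraic semigroup automorphisms of $I(P)$ is equal to the group of $k$-algebra automorphisms of $I(P)$.
   Context: The incidence algebra of $P$ over $k$ is $I(P)=\{f:P\times P\to k : f(x,y)=0 \text{ unless } x\le y\}$ with pointwise addition and scalar multiplication and the convolution product $(f\cdot g)(x,y)=\sum_{x\le z\le y} f(x,z)g(z,y)$. As a variety, $I(P)$ is an affine space and the multiplication is a morphism, so $I(P)$ is a linear algebraic monoid. An algebraic semigroup automorphism of $I(P)$ is an automorphism of the variety $I(P)$ (a bijective morphism whose inverse is a morphism) that preserves multiplication. -}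

module Defs where

open import Level using (Level; _⊔_)
open import Data.Nat using (ℕ; zero; suc)
open import Data.Fin using (Fin; zero; suc)
open import Data.List using (List; []; _∷_; length)
open import Data.Product using (Σ; _×_; _,_; ∃)
open import Relation.Nullary using (¬_; yes; no)
open import Relation.Binary.Core using (Rel)
open import Relation.Binary.Definitions using (Decidable)
open import Relation.Binary.Structures using (IsPartialOrder)
open import Relation.Binary.PropositionalEquality using (_≡_)
open import Algebra.Bundles using (CommutativeRing)

record IsField {c ℓ : Level} (R : CommutativeRing c ℓ) : Set (c ⊔ ℓ) where
  open CommutativeRing R using (Carrier; _≈_; _*_; 0#; 1#)
  field
    1≉0 : ¬ (1# ≈ 0#)
    inverse : ∀ x → ¬ (x ≈ 0#) → Σ Carrier λ y → x * y ≈ 1#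

module _ {c ℓ : Level} (R : CommutativeRing c ℓ) where
  open CommutativeRing R using (Carrier; _≈_; _+_; _*_; 0#; 1#)

  _^_ : Carrier → ℕ → Carrier
  x ^ zero = 1#
  x ^ suc m = x * (x ^ m)

  evalCoeffs : List Carrier → Carrier → Carrier
  evalCoeffs [] x = 0#
  evalCoeffs (a ∷ cs) x = a + x * evalCoeffs cs x

  IsAlgClosed : Set (c ⊔ ℓ)
  IsAlgClosed = ∀ (a : Carrier) (cs : List Carrier) →
    let as = a ∷ cs in
    Σ Carrier λ x → (x ^ length as) + evalCoeffs as x ≈ 0#

  sumFin : (n : ℕ) → (Fin n → Carrier) → Carrier
  sumFin zero f = 0#
  sumFin (suc m) f = f zero + sumFin m (λ i → f (suc i))

  data Poly (V : Set) : Set c where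
    var : V → Poly V
    con : Carrier → Poly V
    _⊕_ : Poly V → Poly V → Poly V
    _⊗_ : Poly V → Poly V → Poly V

  evalPoly : {V : Set} → Poly V → (V → Carrier) → Carrier
  evalPoly (var v) ρ = ρ v
  evalPoly (con a) ρ = a
  evalPoly (p ⊕ q) ρ = evalPoly p ρ + evalPoly q ρ
  evalPoly (p ⊗ q) ρ = evalPoly p ρ * evalPoly q ρ

  module Incidence (n : ℕ) (_≤ₚ_ : Rel (Fin n) Level.zero)
                   (_≤?_ : Decidable _≤ₚ_) where

    Fun : Set c
    Fun = Fin n → Fin n → Carrier

    InI : Fun → Set ℓ
    InI f = ∀ x y → ¬ (x ≤ₚ y) → f x y ≈ 0#

    _≋_ : Fun → Fun → Set ℓ
    f ≋ g = ∀ x y → f x y ≈ g x y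

    _+ᴵ_ : Fun → Fun → Fun
    (f +ᴵ g) x y = f x y + g x y

    _·ᴵ_ : Carrier → Fun → Fun
    (a ·ᴵ f) x y = a * f x y

    term : Fun → Fun → Fin n → Fin n → Fin n → Carrier
    term f g x y z with x ≤? z | z ≤? y
    ... | yes _ | yes _ = f x z * g z y
    ... | _     | _     = 0#

    _*ᴵ_ : Fun → Fun → Fun
    (f *ᴵ g) x y = sumFin n (term f g x y)

    δ : Fun
    δ x y with x Data.Fin.≟ y
    ... | yes _ = 1#
    ... | no _  = 0#

    -- a map I(P) → I(P) (defined on all of Fun, only its values on I(P) matter)
    MapsInto : (Fun → Fun) → Set (c ⊔ ℓ)
    MapsInto φ = ∀ f → InI f → InI (φ f)

    -- φ is a morphism of varieties I(P) → I(P): each coordinate of φ is given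
    -- by a polynomial in the coordinates f(x,y) (x ≤ y) of the argument
    -- (coordinates with x ≰ y vanish on I(P), so using all (x,y) as variables
    -- gives exactly the polynomials in the coordinates of I(P)).
    IsMorphism : (Fun → Fun) → Set (c ⊔ ℓ)
    IsMorphism φ = MapsInto φ ×
      Σ (Fin n → Fin n → Poly (Fin n × Fin n)) λ p →
        ∀ f → InI f → ∀ x y → φ f x y ≈ evalPoly (p x y) (λ { (u , v) → f u v })

    IsInverse : (Fun → Fun) → (Fun → Fun) → Set (c ⊔ ℓ)
    IsInverse φ ψ = MapsInto ψ ×
      ((∀ f → InI f → ψ (φ f) ≋ f) × (∀ f → InI f → φ (ψ f) ≋ f))

    IsSGAut : (Fun → Fun) → Set (c ⊔ ℓ)
    IsSGAut φ = IsMorphism φ ×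
      (Σ (Fun → Fun) λ ψ → IsMorphism ψ × IsInverse φ ψ) ×
      (∀ f g → InI f → InI g → φ (f *ᴵ g) ≋ (φ f *ᴵ φ g))

    IsAlgAut : (Fun → Fun) → Set (c ⊔ ℓ)
    IsAlgAut φ = MapsInto φ ×
      (∀ f g → InI f → InI g → f ≋ g → φ f ≋ φ g) ×
      (Σ (Fun → Fun) λ ψ → IsInverse φ ψ) ×
      (∀ f g → InI f → InI g → φ (f +ᴵ g) ≋ (φ f +ᴵ φ g)) ×
      (∀ a f → InI f → φ (a ·ᴵ f) ≋ (a ·ᴵ φ f)) ×
      (∀ f g → InI f → InI g → φ (f *ᴵ g) ≋ (φ f *ᴵ φ g)) ×
      (φ δ ≋ δ)

{-# OPTIONS --safe #-}
module Submission where

-- A multiplicative automorphism φ with polynomial inverse ψ satisfies φ(tf) = φ(tδ) φ(f).  Comparing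
-- coefficients of t gives L f = C φ(f), where L is the differential of φ at 0 and C = L δ; applied
-- to tf instead of f, it also gives C (L f) = L f.  By the chain rule L is inverse to the
-- differential of ψ, so C g = g for every g in I(P) and φ = L is linear.  Only the unit of I(P) enters.
--
-- Conversely, linear maps are polynomial.  The inverse in IsAlgAut is not assumed to respect ≋, so
-- its linearity rests on the fact that a surjective endomorphism of a finite free module is injective.
--
-- Equality in the field is not assumed decidable or stable, and nilpotents cannot be excluded.  All
-- arguments therefore work over a commutative ring, and algebraic closedness serves only to show that
-- a polynomial function determines its coefficients.

open import Defs
open import Level using (Level; _⊔_)
open import Data.Nat using (ℕ; zero; suc)
import Data.Nat as ℕ
import Data.Nat.Properties as ℕₚ
open import Data.Fin using (Fin; zero; suc; punchIn; punchOut; remQuot; combine)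
import Data.Fin.Properties as Finₚ
open import Data.Bool using (if_then_else_)
open import Data.Empty using (⊥-elim)
open import Data.List using (List; []; _∷_; length; map)
open import Data.List.Relation.Unary.All as All using (All; []; _∷_)
open import Data.Product using (Σ; _×_; _,_; proj₁; proj₂)
open import Data.Vec.Functional using (removeAt)
open import Function using (_∘_)
open import Relation.Nullary using (¬_; yes; no; does)
open import Relation.Binary.Core using (Rel)
open import Relation.Binary.Definitions using (Decidable)
open import Relation.Binary.Structures using (IsPartialOrder)
open import Relation.Binary.PropositionalEquality as ≡ using (_≡_)
open import Algebra.Bundles using (CommutativeRing)
import Algebra.Properties.CommutativeMonoid.Sum as CommutativeMonoidSum
import Algebra.Properties.CommutativeSemiring.Exp as CommExp
import Algebra.Properties.Semiring.Exp as Exp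
import Algebra.Properties.Semiring.Sum as SemiringSum
import Algebra.Solver.Ring.NaturalCoefficients.Default as SemiringSolver
import Algebra.Properties.Ring as RingProperties
import Relation.Binary.Reasoning.Setoid as SetoidReasoning

module _ {c ℓ : Level} (R : CommutativeRing c ℓ) where
  open CommutativeRing R hiding (zero)
  open SemiringSolver commutativeSemiring using (solve; _:+_; _:*_; _:=_; con)
  open RingProperties ring using (-1*x≈-x)
  open SetoidReasoning setoid

  -- Univariate polynomials as coefficient lists, and the vanishing of those that are zero as
  -- functions.

  eval : List Carrier → Carrier → Carrier
  eval = evalCoeffs R

  monicEval : List Carrier → Carrier → Carrier
  monicEval as t = (_^_ R t (length as)) + eval as t

  -- Negatives are written `- 1# * x` throughout, so that the semiring solver can treat `- 1#`, or
  -- the whole product, as one more variable. The law of additive inverses is then applied by hand,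
  -- through this lemma and `neg-cancel`.
  neg+self : ∀ x → - 1# * x + x ≈ 0#
  neg+self x = trans (+-congʳ (-1*x≈-x x)) (-‿inverseˡ x)

  neg-cancel : ∀ {x y} → x + - 1# * y ≈ 0# → x ≈ y
  neg-cancel {x} {y} x-y≈0 = begin
    x                    ≈⟨ +-identityʳ x ⟨
    x + 0#               ≈⟨ +-congˡ (neg+self y) ⟨
    x + (- 1# * y + y)   ≈⟨ +-assoc x _ y ⟨
    (x + - 1# * y) + y   ≈⟨ +-congʳ x-y≈0 ⟩
    0# + y               ≈⟨ +-identityˡ y ⟩
    y                    ∎

  -- Lower coefficients of b + (t + v) m(t), for m monic with lower coefficients as.
  addLinMul : Carrier → Carrier → List Carrier → List Carrier
  addLinMul b v [] = (b + v) ∷ []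
  addLinMul b v (a ∷ as) = (b + v * a) ∷ addLinMul a v as

  -- With m(t) = a + t m'(t), b + (t + v) m(t) = (b + v a) + t (a + (t + v) m'(t)). The bracket has
  -- the same shape, with `a` in the place of `b`.
  monicEval-addLinMul : ∀ b v as t →
    monicEval (addLinMul b v as) t ≈ b + (t + v) * monicEval as t
  monicEval-addLinMul b v [] t =
    solve 3 (λ b v t → (t :* con 1) :+ ((b :+ v) :+ t :* con 0)
                     := b :+ (t :+ v) :* (con 1 :+ con 0)) refl b v t
  monicEval-addLinMul b v (a ∷ as) t = begin
    t * tᵏ + ((b + v * a) + t * e)                 ≈⟨ solve 6 (λ t tᵏ b v a e →
                                                        t :* tᵏ :+ ((b :+ v :* a) :+ t :* e)
                                                        := b :+ v :* a :+ t :* (tᵏ :+ e)) refl t tᵏ b v a e ⟩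
    b + v * a + t * (tᵏ + e)                       ≈⟨ +-congˡ (*-congˡ (monicEval-addLinMul a v as t)) ⟩
    b + v * a + t * (a + (t + v) * (tᵐ + eval as t)) ≈⟨ solve 6 (λ t tᵐ b v a e →
                                                        b :+ v :* a :+ t :* (a :+ (t :+ v) :* (tᵐ :+ e))
                                                        := b :+ (t :+ v) :* (t :* tᵐ :+ (a :+ t :* e)))
                                                        refl t tᵐ b v a (eval as t) ⟩
    b + (t + v) * (t * tᵐ + (a + t * eval as t))   ∎
    where
    tᵏ = _^_ R t (length (addLinMul a v as))
    tᵐ = _^_ R t (length as)
    e  = eval (addLinMul a v as) t

  -- Quotient of b + t c(t) by t - x; it does not depend on b.
  synthDiv : Carrier → List Carrier → List Carrier
  synthDiv x [] = []
  synthDiv x (c ∷ cs) = eval (c ∷ cs) x ∷ synthDiv x cs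

  length-synthDiv : ∀ x cs → length (synthDiv x cs) ≡ length cs
  length-synthDiv x [] = ≡.refl
  length-synthDiv x (c ∷ cs) = ≡.cong suc (length-synthDiv x cs)

  -- Horner's scheme: the value at x of each tail of the coefficient list is at once a coefficient
  -- of the quotient and the remainder of dividing that tail.
  eval-synthDiv : ∀ x b cs t →
    (t + - 1# * x) * eval (synthDiv x cs) t + eval (b ∷ cs) x ≈ eval (b ∷ cs) t
  eval-synthDiv x b [] t =
    solve 4 (λ t v b x → (t :+ v) :* con 0 :+ (b :+ x :* con 0) := b :+ t :* con 0)
      refl t (- 1# * x) b x
  eval-synthDiv x b (c ∷ cs) t = begin
    (t + v) * (r + t * q) + (b + x * r) ≈⟨ solve 6 (λ t v r q b x →
                                             (t :+ v) :* (r :+ t :* q) :+ (b :+ x :* r)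
                                             := (b :+ t :* ((t :+ v) :* q :+ r)) :+ (v :+ x) :* r)
                                             refl t v r q b x ⟩
    (b + t * ((t + v) * q + r)) + (v + x) * r
      ≈⟨ +-cong (+-congˡ (*-congˡ (eval-synthDiv x c cs t))) (trans (*-congʳ (neg+self x)) (zeroˡ r)) ⟩
    (b + t * eval (c ∷ cs) t) + 0#      ≈⟨ +-identityʳ _ ⟩
    b + t * eval (c ∷ cs) t             ∎
    where
    v = - 1# * x
    r = eval (c ∷ cs) x
    q = eval (synthDiv x cs) t

  All≈0 : List Carrier → Set (c ⊔ ℓ)
  All≈0 = All (_≈ 0#)

  eval-All≈0 : ∀ {cs} → All≈0 cs → ∀ t → eval cs t ≈ 0#
  eval-All≈0 [] t = refl
  eval-All≈0 (c≈0 ∷ cs≈0) t =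
    trans (+-cong c≈0 (trans (*-congˡ (eval-All≈0 cs≈0 t)) (zeroʳ t))) (+-identityˡ 0#)

  -- The coefficients can be read back from quotient and remainder: b = q(x) - x r, where r, the
  -- head of the quotient, is the value at x of the tail. As r = 0, the same argument continues with
  -- the tail.
  synthDiv≈0 : ∀ x b cs → eval (b ∷ cs) x ≈ 0# → All≈0 (synthDiv x cs) → All≈0 (b ∷ cs)
  synthDiv≈0 x b [] q≈0 [] =
    trans (sym (trans (+-congˡ (zeroʳ x)) (+-identityʳ b))) q≈0 ∷ []
  synthDiv≈0 x b (c ∷ cs) q≈0 (r≈0 ∷ rs≈0) =
    trans (sym (trans (+-congˡ (trans (*-congˡ r≈0) (zeroʳ x))) (+-identityʳ b))) q≈0
    ∷ synthDiv≈0 x c cs r≈0 rs≈0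

  module _ (algClosed : IsAlgClosed R) where

    -- At a root x of 1 + t m(t), the value m(x) has the inverse - x.
    monic-unit : ∀ as → Σ Carrier λ x → Σ Carrier λ y → y * monicEval as x ≈ 1#
    monic-unit as with algClosed 1# as
    ... | x , root = x , - 1# * x , neg-cancel (begin
      (- 1# * x) * (xᵐ + e) + - 1# * 1#    ≈⟨ solve 4 (λ n x xᵐ e →
                                                (n :* x) :* (xᵐ :+ e) :+ n :* con 1
                                                := n :* (x :* xᵐ :+ (con 1 :+ x :* e)))
                                                refl (- 1#) x xᵐ e ⟩
      - 1# * (x * xᵐ + (1# + x * e))       ≈⟨ *-congˡ root ⟩
      - 1# * 0#                            ≈⟨ zeroʳ _ ⟩
      0#                                   ∎)
      where
      xᵐ = _^_ R x (length as)
      e = eval as x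

    -- The monic factor m collects the zeros of q already divided out: where m(x) is a unit, q(x) = 0,
    -- so that t - x moves from q to m.
    monic*≈0⇒All≈0 : ∀ k as cs → length cs ≡ k →
      (∀ t → monicEval as t * eval cs t ≈ 0#) → All≈0 cs
    monic*≈0⇒All≈0 k as [] len mq≈0 = []
    monic*≈0⇒All≈0 (suc k) as (c ∷ cs) len mq≈0 with monic-unit as
    ... | x , y , ym≈1 = synthDiv≈0 x c cs qx≈0
          -- The recursion runs on the length `k`, because the quotient is not a sublist of
          -- `c ∷ cs`. With b = 0, `addLinMul` lists the lower coefficients of (t - x) m(t).
          (monic*≈0⇒All≈0 k (addLinMul 0# v as) (synthDiv x cs)
            (≡.trans (length-synthDiv x cs) (ℕₚ.suc-injective len)) m′q′≈0)
      where
      v = - 1# * x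

      qx≈0 : eval (c ∷ cs) x ≈ 0#
      qx≈0 = begin
        eval (c ∷ cs) x                       ≈⟨ *-identityˡ _ ⟨
        1# * eval (c ∷ cs) x                  ≈⟨ *-congʳ ym≈1 ⟨
        y * monicEval as x * eval (c ∷ cs) x  ≈⟨ *-assoc _ _ _ ⟩
        y * (monicEval as x * eval (c ∷ cs) x) ≈⟨ *-congˡ (mq≈0 x) ⟩
        y * 0#                                ≈⟨ zeroʳ y ⟩
        0#                                    ∎

      m′q′≈0 : ∀ t → monicEval (addLinMul 0# v as) t * eval (synthDiv x cs) t ≈ 0#
      m′q′≈0 t = begin
        monicEval (addLinMul 0# v as) t * q′   ≈⟨ *-congʳ (monicEval-addLinMul 0# v as t) ⟩
        (0# + (t + v) * m) * q′                ≈⟨ solve 4 (λ t v m q′ → (con 0 :+ (t :+ v) :* m) :* q′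
                                                    := m :* ((t :+ v) :* q′ :+ con 0)) refl t v m q′ ⟩
        m * ((t + v) * q′ + 0#)                ≈⟨ *-congˡ (+-congˡ qx≈0) ⟨
        m * ((t + v) * q′ + eval (c ∷ cs) x)   ≈⟨ *-congˡ (eval-synthDiv x c cs t) ⟩
        m * eval (c ∷ cs) t                    ≈⟨ mq≈0 t ⟩
        0#                                     ∎
        where
        m = monicEval as t
        q′ = eval (synthDiv x cs) t

    -- The induction starts with m = 1, the monic polynomial whose list of lower coefficients is
    -- empty. Counting distinct roots would call for deciding equality of scalars; collecting the
    -- roots in m does not.
    eval≈0⇒All≈0 : ∀ cs → (∀ t → eval cs t ≈ 0#) → All≈0 cs
    eval≈0⇒All≈0 cs q≈0 =
      monic*≈0⇒All≈0 (length cs) [] cs ≡.refl λ t → trans (*-congˡ (q≈0 t)) (zeroʳ _)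

  -- Polynomial functions and their first-order jets.

  addᶜ : List Carrier → List Carrier → List Carrier
  addᶜ [] ds = ds
  addᶜ (c ∷ cs) [] = c ∷ cs
  addᶜ (c ∷ cs) (d ∷ ds) = (c + d) ∷ addᶜ cs ds

  eval-addᶜ : ∀ cs ds t → eval (addᶜ cs ds) t ≈ eval cs t + eval ds t
  eval-addᶜ [] ds t = sym (+-identityˡ _)
  eval-addᶜ (c ∷ cs) [] t = sym (+-identityʳ _)
  eval-addᶜ (c ∷ cs) (d ∷ ds) t = begin
    (c + d) + t * eval (addᶜ cs ds) t              ≈⟨ +-congˡ (*-congˡ (eval-addᶜ cs ds t)) ⟩
    (c + d) + t * (eval cs t + eval ds t)          ≈⟨ solve 5 (λ c d t p q →
                                                        (c :+ d) :+ t :* (p :+ q)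
                                                        := (c :+ t :* p) :+ (d :+ t :* q))
                                                        refl c d t (eval cs t) (eval ds t) ⟩
    (c + t * eval cs t) + (d + t * eval ds t)      ∎

  eval-scale : ∀ a cs t → eval (map (a *_) cs) t ≈ a * eval cs t
  eval-scale a [] t = sym (zeroʳ a)
  eval-scale a (c ∷ cs) t = begin
    a * c + t * eval (map (a *_) cs) t   ≈⟨ +-congˡ (*-congˡ (eval-scale a cs t)) ⟩
    a * c + t * (a * eval cs t)          ≈⟨ solve 4 (λ a c t p → a :* c :+ t :* (a :* p)
                                              := a :* (c :+ t :* p)) refl a c t (eval cs t) ⟩
    a * (c + t * eval cs t)              ∎

  mulᶜ : List Carrier → List Carrier → List Carrier
  mulᶜ [] ds = []
  mulᶜ (c ∷ cs) ds = addᶜ (map (c *_) ds) (0# ∷ mulᶜ cs ds)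

  eval-mulᶜ : ∀ cs ds t → eval (mulᶜ cs ds) t ≈ eval cs t * eval ds t
  eval-mulᶜ [] ds t = sym (zeroˡ _)
  eval-mulᶜ (c ∷ cs) ds t = begin
    eval (addᶜ (map (c *_) ds) (0# ∷ mulᶜ cs ds)) t          ≈⟨ eval-addᶜ (map (c *_) ds) _ t ⟩
    eval (map (c *_) ds) t + (0# + t * eval (mulᶜ cs ds) t)
      ≈⟨ +-cong (eval-scale c ds t) (+-congˡ (*-congˡ (eval-mulᶜ cs ds t))) ⟩
    c * eval ds t + (0# + t * (eval cs t * eval ds t))       ≈⟨ solve 4 (λ c t p q →
                                                                  c :* q :+ (con 0 :+ t :* (p :* q))
                                                                  := (c :+ t :* p) :* q)
                                                                  refl c t (eval cs t) (eval ds t) ⟩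
    (c + t * eval cs t) * eval ds t                          ∎

  IsPolyFun : (Carrier → Carrier) → Set (c ⊔ ℓ)
  IsPolyFun h = Σ (List Carrier) λ cs → ∀ t → h t ≈ eval cs t

  polyFun-const : ∀ a → IsPolyFun (λ _ → a)
  polyFun-const a = (a ∷ []) , λ t → sym (trans (+-congˡ (zeroʳ t)) (+-identityʳ a))

  polyFun-id : IsPolyFun (λ t → t)
  polyFun-id = (0# ∷ 1# ∷ []) , λ t →
    solve 1 (λ t → t := con 0 :+ t :* (con 1 :+ t :* con 0)) refl t

  polyFun-+ : ∀ {h k} → IsPolyFun h → IsPolyFun k → IsPolyFun (λ t → h t + k t)
  polyFun-+ (cs , h≈) (ds , k≈) =
    addᶜ cs ds , λ t → trans (+-cong (h≈ t) (k≈ t)) (sym (eval-addᶜ cs ds t))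

  polyFun-* : ∀ {h k} → IsPolyFun h → IsPolyFun k → IsPolyFun (λ t → h t * k t)
  polyFun-* (cs , h≈) (ds , k≈) =
    mulᶜ cs ds , λ t → trans (*-cong (h≈ t) (k≈ t)) (sym (eval-mulᶜ cs ds t))

  -- h is a polynomial function congruent to a + b t modulo t².
  HasJet : (Carrier → Carrier) → Carrier → Carrier → Set (c ⊔ ℓ)
  HasJet h a b = Σ (Carrier → Carrier) λ r →
    IsPolyFun r × (∀ t → h t ≈ a + t * (b + t * r t))

  jet-cong : ∀ {h k a a′ b b′} → (∀ t → h t ≈ k t) → a ≈ a′ → b ≈ b′ → HasJet h a b → HasJet k a′ b′
  jet-cong h≈k a≈a′ b≈b′ (r , r-poly , h≈) = r , r-poly , λ t →
    trans (sym (h≈k t)) (trans (h≈ t) (+-cong a≈a′ (*-congˡ (+-congʳ b≈b′))))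

  jet-const : ∀ a → HasJet (λ _ → a) a 0#
  jet-const a = (λ _ → 0#) , polyFun-const 0# , λ t →
    solve 2 (λ a t → a := a :+ t :* (con 0 :+ t :* con 0)) refl a t

  jet-line : ∀ b → HasJet (λ t → t * b) 0# b
  jet-line b = (λ _ → 0#) , polyFun-const 0# , λ t →
    solve 2 (λ b t → t :* b := con 0 :+ t :* (b :+ t :* con 0)) refl b t

  jet-+ : ∀ {h k a b a′ b′} → HasJet h a b → HasJet k a′ b′ →
    HasJet (λ t → h t + k t) (a + a′) (b + b′)
  jet-+ {a = a} {b} {a′} {b′} (r , r-poly , h≈) (s , s-poly , k≈) =
    (λ t → r t + s t) , polyFun-+ r-poly s-poly , λ t →
    trans (+-cong (h≈ t) (k≈ t))
      (solve 7 (λ a b a′ b′ t r s →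
        (a :+ t :* (b :+ t :* r)) :+ (a′ :+ t :* (b′ :+ t :* s))
        := (a :+ a′) :+ t :* ((b :+ b′) :+ t :* (r :+ s))) refl a b a′ b′ t (r t) (s t))

  jet-* : ∀ {h k a b a′ b′} → HasJet h a b → HasJet k a′ b′ →
    HasJet (λ t → h t * k t) (a * a′) (b * a′ + a * b′)
  jet-* {a = a} {b} {a′} {b′} (r , r-poly , h≈) (s , s-poly , k≈) =
    -- All terms of the product that carry a factor t², with that factor removed.
    (λ t → (a * s t + r t * a′) + (b + t * r t) * (b′ + t * s t)) ,
    polyFun-+ (polyFun-+ (polyFun-* (polyFun-const a) s-poly) (polyFun-* r-poly (polyFun-const a′)))
      (polyFun-* (tail-poly b r-poly) (tail-poly b′ s-poly)) ,
    λ t → trans (*-cong (h≈ t) (k≈ t))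
      (solve 7 (λ a b a′ b′ t r s →
        (a :+ t :* (b :+ t :* r)) :* (a′ :+ t :* (b′ :+ t :* s))
        := a :* a′ :+ t :* ((b :* a′ :+ a :* b′)
             :+ t :* ((a :* s :+ r :* a′) :+ (b :+ t :* r) :* (b′ :+ t :* s))))
        refl a b a′ b′ t (r t) (s t))
    where
    tail-poly : ∀ d {u} → IsPolyFun u → IsPolyFun (λ t → d + t * u t)
    tail-poly d u-poly = polyFun-+ (polyFun-const d) (polyFun-* polyFun-id u-poly)

  jet-*ʳ : ∀ {h a b} k → HasJet h a b → HasJet (λ t → h t * k) (a * k) (b * k)
  jet-*ʳ {a = a} k jet = jet-cong (λ _ → refl) refl
    (trans (+-congˡ (zeroʳ a)) (+-identityʳ _)) (jet-* jet (jet-const k))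

  jet-*ˡ : ∀ {h a b} k → HasJet h a b → HasJet (λ t → k * h t) (k * a) (k * b)
  jet-*ˡ {a = a} k jet = jet-cong (λ _ → refl) refl
    (trans (+-congʳ (zeroˡ a)) (+-identityˡ _)) (jet-* (jet-const k) jet)

  jet-sumFin : ∀ n {h : Fin n → Carrier → Carrier} {a b} → (∀ i → HasJet (h i) (a i) (b i)) →
    HasJet (λ t → sumFin R n (λ i → h i t)) (sumFin R n a) (sumFin R n b)
  jet-sumFin zero jets = jet-const 0#
  jet-sumFin (suc n) jets = jet-+ (jets zero) (jet-sumFin n (λ i → jets (suc i)))

  -- The difference of the two expansions is a polynomial that vanishes at every t, so all its
  -- coefficients vanish, and the second one is b - b′.
  jet-unique : IsAlgClosed R → ∀ {h a b a′ b′} → HasJet h a b → HasJet h a′ b′ → b ≈ b′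
  jet-unique algClosed {h} {a} {b} {a′} {b′} (r , (cs , r≈) , h≈) (s , (ds , s≈) , h≈′) =
    neg-cancel (All.head (All.tail (eval≈0⇒All≈0 algClosed difference difference≈0)))
    where
    n = - 1#
    difference = (a + n * a′) ∷ (b + n * b′) ∷ addᶜ cs (map (n *_) ds)

    difference≈0 : ∀ t → eval difference t ≈ 0#
    difference≈0 t = begin
      (a + n * a′) + t * ((b + n * b′) + t * eval (addᶜ cs (map (n *_) ds)) t)
        ≈⟨ +-congˡ (*-congˡ (+-congˡ (*-congˡ (trans (eval-addᶜ cs _ t)
             (+-cong (sym (r≈ t)) (trans (eval-scale n ds t) (*-congˡ (sym (s≈ t))))))))) ⟩
      (a + n * a′) + t * ((b + n * b′) + t * (r t + n * s t))
        ≈⟨ solve 8 (λ n a b a′ b′ t r s →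
             (a :+ n :* a′) :+ t :* ((b :+ n :* b′) :+ t :* (r :+ n :* s))
             := n :* (a′ :+ t :* (b′ :+ t :* s)) :+ (a :+ t :* (b :+ t :* r)))
             refl n a b a′ b′ t (r t) (s t) ⟩
      n * (a′ + t * (b′ + t * s t)) + (a + t * (b + t * r t))
        ≈⟨ +-cong (*-congˡ (h≈′ t)) (h≈ t) ⟨
      n * h t + h t
        ≈⟨ neg+self (h t) ⟩
      0# ∎

  -- Formal derivatives of polynomial expressions.

  evalPoly-cong : ∀ {V} (p : Poly R V) {ρ σ : V → Carrier} → (∀ v → ρ v ≈ σ v) →
    evalPoly R p ρ ≈ evalPoly R p σ
  evalPoly-cong (var v) ρ≈σ = ρ≈σ v
  evalPoly-cong (con a) ρ≈σ = refl
  evalPoly-cong (p ⊕ q) ρ≈σ = +-cong (evalPoly-cong p ρ≈σ) (evalPoly-cong q ρ≈σ)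
  evalPoly-cong (p ⊗ q) ρ≈σ = *-cong (evalPoly-cong p ρ≈σ) (evalPoly-cong q ρ≈σ)

  -- The formal directional derivative at `ρ` along `d`. It is computed from the expression;
  -- `jet-evalPoly` ties it to the function.
  deriv : ∀ {V} → Poly R V → (V → Carrier) → (V → Carrier) → Carrier
  deriv (var v) ρ d = d v
  deriv (con a) ρ d = 0#
  deriv (p ⊕ q) ρ d = deriv p ρ d + deriv q ρ d
  deriv (p ⊗ q) ρ d = deriv p ρ d * evalPoly R q ρ + evalPoly R p ρ * deriv q ρ d

  deriv-cong : ∀ {V} (p : Poly R V) ρ {d e} → (∀ v → d v ≈ e v) → deriv p ρ d ≈ deriv p ρ e
  deriv-cong (var v) ρ d≈e = d≈e v
  deriv-cong (con a) ρ d≈e = refl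
  deriv-cong (p ⊕ q) ρ d≈e = +-cong (deriv-cong p ρ d≈e) (deriv-cong q ρ d≈e)
  deriv-cong (p ⊗ q) ρ d≈e = +-cong (*-congʳ (deriv-cong p ρ d≈e)) (*-congˡ (deriv-cong q ρ d≈e))

  deriv-+ : ∀ {V} (p : Poly R V) ρ d e →
    deriv p ρ (λ v → d v + e v) ≈ deriv p ρ d + deriv p ρ e
  deriv-+ (var v) ρ d e = refl
  deriv-+ (con a) ρ d e = sym (+-identityʳ 0#)
  deriv-+ (p ⊕ q) ρ d e = trans (+-cong (deriv-+ p ρ d e) (deriv-+ q ρ d e))
    (solve 4 (λ a b a′ b′ → (a :+ b) :+ (a′ :+ b′) := (a :+ a′) :+ (b :+ b′)) refl _ _ _ _)
  deriv-+ (p ⊗ q) ρ d e = trans (+-cong (*-congʳ (deriv-+ p ρ d e)) (*-congˡ (deriv-+ q ρ d e)))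
    (solve 6 (λ a b a′ b′ u v → (a :+ b) :* u :+ v :* (a′ :+ b′)
                := (a :* u :+ v :* a′) :+ (b :* u :+ v :* b′)) refl _ _ _ _ _ _)

  deriv-* : ∀ {V} (p : Poly R V) ρ a d → deriv p ρ (λ v → a * d v) ≈ a * deriv p ρ d
  deriv-* (var v) ρ a d = refl
  deriv-* (con b) ρ a d = sym (zeroʳ a)
  deriv-* (p ⊕ q) ρ a d = trans (+-cong (deriv-* p ρ a d) (deriv-* q ρ a d)) (sym (distribˡ a _ _))
  deriv-* (p ⊗ q) ρ a d = trans (+-cong (*-congʳ (deriv-* p ρ a d)) (*-congˡ (deriv-* q ρ a d)))
    (solve 5 (λ a b b′ u v → a :* b :* u :+ v :* (a :* b′) := a :* (b :* u :+ v :* b′))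
      refl _ _ _ _ _)

  -- The chain rule to first order, by the sum and Leibniz rules for jets. The curve `γ` is
  -- arbitrary rather than a line, so that the lemma also covers composites of morphisms.
  jet-evalPoly : ∀ {V} (p : Poly R V) {γ : V → Carrier → Carrier} {ρ d} →
    (∀ v → HasJet (γ v) (ρ v) (d v)) →
    HasJet (λ t → evalPoly R p (λ v → γ v t)) (evalPoly R p ρ) (deriv p ρ d)
  jet-evalPoly (var v) jets = jets v
  jet-evalPoly (con a) jets = jet-const a
  jet-evalPoly (p ⊕ q) jets = jet-+ (jet-evalPoly p jets) (jet-evalPoly q jets)
  jet-evalPoly (p ⊗ q) jets = jet-* (jet-evalPoly p jets) (jet-evalPoly q jets)

  -- Finite sums.

  module _ where
    open CommutativeMonoidSum +-commutativeMonoid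

    sum-zero : ∀ {n} {f : Fin n → Carrier} → (∀ i → f i ≈ 0#) → sum f ≈ 0#
    sum-zero {n} f≈0 = trans (sum-cong-≋ f≈0) (sum-replicate-zero n)

    sum-single : ∀ {n} (i : Fin n) {f : Fin n → Carrier} → (∀ j → ¬ (i ≡ j) → f j ≈ 0#) →
      sum f ≈ f i
    sum-single {suc n} i {f} f≈0 = begin
      sum f                    ≈⟨ sum-remove {i = i} f ⟩
      f i + sum (removeAt f i) ≈⟨ +-congˡ (sum-zero λ q → f≈0 _ λ eq → Finₚ.punchInᵢ≢i i q (≡.sym eq)) ⟩
      f i + 0#                 ≈⟨ +-identityʳ _ ⟩
      f i                      ∎

    sumFin≡sum : ∀ n (f : Fin n → Carrier) → sumFin R n f ≡ sum f
    sumFin≡sum zero f = ≡.refl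
    sumFin≡sum (suc n) f = ≡.cong (f zero +_) (sumFin≡sum n (λ i → f (suc i)))

    sumFin-cong : ∀ n {f g : Fin n → Carrier} → (∀ i → f i ≈ g i) → sumFin R n f ≈ sumFin R n g
    sumFin-cong n {f} {g} f≈g rewrite sumFin≡sum n f | sumFin≡sum n g = sum-cong-≋ f≈g

    sumFin-zero : ∀ n {f : Fin n → Carrier} → (∀ i → f i ≈ 0#) → sumFin R n f ≈ 0#
    sumFin-zero n {f} f≈0 rewrite sumFin≡sum n f = sum-zero f≈0

    sumFin-single : ∀ n (i : Fin n) {f : Fin n → Carrier} → (∀ j → ¬ (i ≡ j) → f j ≈ 0#) →
      sumFin R n f ≈ f i
    sumFin-single n i {f} f≈0 rewrite sumFin≡sum n f = sum-single i f≈0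

  -- Linear algebra over a commutative ring: surjective endomorphisms are injective.

  module _ where
    open CommutativeMonoidSum +-commutativeMonoid
    open SemiringSum semiring using (*-distribˡ-sum)
    open Exp semiring using (^-homo-*; ^-congˡ) renaming (_^_ to _^′_)
    open CommExp commutativeSemiring using (^-distrib-*)

    -- Every monomial of the expanded power contains aᵏ or bˡ. Instead of expanding, one factor a +
    -- b is split off, and a x and b x take the place of x: one power of a less kills a x, and one
    -- power of b less kills b x.
    annihilated-+ : ∀ k l {a b x} → a ^′ k * x ≈ 0# → b ^′ l * x ≈ 0# → (a + b) ^′ (k ℕ.+ l) * x ≈ 0#
    annihilated-+ zero l aᵏx≈0 bˡx≈0 =
      trans (*-congˡ (trans (sym (*-identityˡ _)) aᵏx≈0)) (zeroʳ _)
    annihilated-+ (suc k) zero aᵏx≈0 bˡx≈0 =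
      trans (*-congˡ (trans (sym (*-identityˡ _)) bˡx≈0)) (zeroʳ _)
    annihilated-+ (suc k) (suc l) {a} {b} {x} aᵏx≈0 bˡx≈0 = begin
      ((a + b) * e) * x            ≈⟨ solve 4 (λ a b e x → ((a :+ b) :* e) :* x
                                       := e :* (a :* x) :+ e :* (b :* x)) refl a b e x ⟩
      e * (a * x) + e * (b * x)    ≈⟨ +-cong first second ⟩
      0# + 0#                      ≈⟨ +-identityʳ 0# ⟩
      0#                           ∎
      where
      e = (a + b) ^′ (k ℕ.+ suc l)

      shift : ∀ p y → p * (y * x) ≈ (y * p) * x
      shift p y = solve 3 (λ p y x → p :* (y :* x) := (y :* p) :* x) refl p y x

      move : ∀ y {z} → z * x ≈ 0# → z * (y * x) ≈ 0#
      move y {z} zx≈0 = trans (shift z y) (trans (*-assoc y z x) (trans (*-congˡ zx≈0) (zeroʳ y)))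

      first : e * (a * x) ≈ 0#
      first = annihilated-+ k (suc l) (trans (shift _ a) aᵏx≈0) (move a bˡx≈0)

      second : e * (b * x) ≈ 0#
      -- The exponent k + (l + 1) of `e` is brought to the form (k + 1) + l required by the
      -- recursive call.
      second rewrite ℕₚ.+-suc k l =
        annihilated-+ (suc k) l (move b aᵏx≈0) (trans (shift _ b) bˡx≈0)

    -- r lies in the radical of the annihilator of the vector x.
    RadAnn : ∀ {N} → (Fin N → Carrier) → Carrier → Set ℓ
    RadAnn x r = Σ ℕ λ k → ∀ i → r ^′ k * x i ≈ 0#

    radAnn-+ : ∀ {N} {x : Fin N → Carrier} {r s} → RadAnn x r → RadAnn x s → RadAnn x (r + s)
    radAnn-+ (k , rᵏx≈0) (l , sˡx≈0) = k ℕ.+ l , λ i → annihilated-+ k l (rᵏx≈0 i) (sˡx≈0 i)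

    radAnn-* : ∀ {N} {x : Fin N → Carrier} {r} s → RadAnn x r → RadAnn x (r * s)
    radAnn-* {x = x} {r} s (k , rᵏx≈0) = k , λ i → begin
      (r * s) ^′ k * x i          ≈⟨ *-congʳ (^-distrib-* r s k) ⟩
      r ^′ k * s ^′ k * x i       ≈⟨ solve 3 (λ p q x → p :* q :* x := q :* (p :* x)) refl _ _ _ ⟩
      s ^′ k * (r ^′ k * x i)     ≈⟨ *-congˡ (rᵏx≈0 i) ⟩
      s ^′ k * 0#                 ≈⟨ zeroʳ _ ⟩
      0#                          ∎

    radAnn-sum : ∀ {N} {x : Fin N → Carrier} m {f : Fin m → Carrier} →
      (∀ j → RadAnn x (f j)) → RadAnn x (sum f)
    radAnn-sum zero f∈ = 1 , λ i → trans (*-congʳ (*-identityʳ 0#)) (zeroˡ _)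
    radAnn-sum (suc m) f∈ = radAnn-+ (f∈ zero) (radAnn-sum m (λ j → f∈ (suc j)))

    radAnn-square : ∀ {N} {x : Fin N → Carrier} {r s} → r ≈ s * s → RadAnn x r → RadAnn x s
    radAnn-square {x = x} {r} {s} r≈s² (k , rᵏx≈0) = k ℕ.+ k , λ i → begin
      s ^′ (k ℕ.+ k) * x i      ≈⟨ *-congʳ (^-homo-* s k k) ⟩
      s ^′ k * s ^′ k * x i     ≈⟨ *-congʳ (^-distrib-* s s k) ⟨
      (s * s) ^′ k * x i        ≈⟨ *-congʳ (^-congˡ k r≈s²) ⟨
      r ^′ k * x i              ≈⟨ rᵏx≈0 i ⟩
      0#                        ∎

    dot : ∀ {N} → (Fin N → Carrier) → (Fin N → Carrier) → Carrier
    dot u v = sum (λ j → u j * v j)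

    dot-linearˡ : ∀ {N} a b (u w v : Fin N → Carrier) →
      dot (λ q → a * u q + b * w q) v ≈ a * dot u v + b * dot w v
    dot-linearˡ a b u w v = begin
      dot (λ q → a * u q + b * w q) v
        ≈⟨ sum-cong-≋ (λ q → solve 5 (λ a b u w v → (a :* u :+ b :* w) :* v
             := a :* (u :* v) :+ b :* (w :* v)) refl a b (u q) (w q) (v q)) ⟩
      sum (λ q → a * (u q * v q) + b * (w q * v q))
        ≈⟨ ∑-distrib-+ (λ q → a * (u q * v q)) (λ q → b * (w q * v q)) ⟩
      sum (λ q → a * (u q * v q)) + sum (λ q → b * (w q * v q))
        ≈⟨ +-cong (*-distribˡ-sum a (λ q → u q * v q)) (*-distribˡ-sum b (λ q → w q * v q)) ⟨
      a * dot u v + b * dot w v ∎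

    punchIn-cases : ∀ {p N} {P : Fin (suc N) → Set p} j → P j → (∀ q → P (punchIn j q)) → ∀ q → P q
    punchIn-cases {P = P} j Pj Ppunch q with j Data.Fin.≟ q
    ... | yes ≡.refl = Pj
    ... | no j≢q = ≡.subst P (Finₚ.punchIn-punchOut j≢q) (Ppunch (punchOut j≢q))

    -- Gaussian elimination without division: clearing column j with the pivot a = A 0 j replaces
    -- the scalar s by a s, so each A 0 j * s is in the radical of the annihilator of x,
    -- and hence so is s * s = ∑ⱼ A 0 j * B 0 j * s.
    rightInverse⇒kernel : ∀ N (A B : Fin N → Fin N → Carrier) s x →
      (∀ i → dot (A i) (B i) ≈ s) → (∀ i l → ¬ (i ≡ l) → dot (A i) (B l) ≈ 0#) →
      (∀ i → dot (A i) x ≈ 0#) → RadAnn x s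
    rightInverse⇒kernel zero A B s x diag off Ax≈0 = 0 , λ ()
    rightInverse⇒kernel (suc N) A B s x diag off Ax≈0 = radAnn-square s²
      (radAnn-sum (suc N) (λ j → radAnn-* (B zero j) (pivot j)))
      where
      s² : sum (λ j → A zero j * s * B zero j) ≈ s * s
      s² = begin
        sum (λ j → A zero j * s * B zero j)     ≈⟨ sum-cong-≋ (λ j →
                                                     solve 3 (λ a s b → a :* s :* b := s :* (a :* b))
                                                     refl (A zero j) s (B zero j)) ⟩
        sum (λ j → s * (A zero j * B zero j))   ≈⟨ *-distribˡ-sum s (λ j → A zero j * B zero j) ⟨
        s * dot (A zero) (B zero)               ≈⟨ *-congˡ (diag zero) ⟩
        s * s                                   ∎

      pivot : ∀ j → RadAnn x (A zero j * s)
      -- The reduced system gives a power e of a s killing every coordinate of `x` except the one at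
      -- j. Multiplying row 0 of A x = 0 by e leaves e a x j = 0, so one more factor a s kills that
      -- coordinate too.
      pivot j = suc (proj₁ reduced) , clear
        where
        a = A zero j

        row : Fin N → Fin (suc N) → Carrier
        row i q = a * A (suc i) q + (- 1# * A (suc i) j) * A zero q

        row-pivot≈0 : ∀ i → row i j ≈ 0#
        row-pivot≈0 i = trans
          (solve 3 (λ a n u → a :* u :+ n :* u :* a := n :* (a :* u) :+ a :* u) refl a (- 1#) (A (suc i) j))
          (neg+self _)

        dot-row : ∀ i v → dot (removeAt (row i) j) (removeAt v j)
          ≈ a * dot (A (suc i)) v + (- 1# * A (suc i) j) * dot (A zero) v
        dot-row i v = begin
          dot (removeAt (row i) j) (removeAt v j)
            ≈⟨ +-identityˡ _ ⟨
          0# + dot (removeAt (row i) j) (removeAt v j)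
            ≈⟨ +-congʳ (trans (*-congʳ (row-pivot≈0 i)) (zeroˡ (v j))) ⟨
          row i j * v j + dot (removeAt (row i) j) (removeAt v j)
            ≈⟨ sum-remove {i = j} (λ q → row i q * v q) ⟨
          dot (row i) v
            ≈⟨ dot-linearˡ a _ (A (suc i)) (A zero) v ⟩
          a * dot (A (suc i)) v + (- 1# * A (suc i) j) * dot (A zero) v ∎

        dot-row≈ : ∀ i v {u} → dot (A (suc i)) v ≈ u → dot (A zero) v ≈ 0# →
          dot (removeAt (row i) j) (removeAt v j) ≈ a * u
        dot-row≈ i v v≈u v≈0 = trans (dot-row i v)
          (trans (+-cong (*-congˡ v≈u) (trans (*-congˡ v≈0) (zeroʳ _))) (+-identityʳ _))

        reduced : RadAnn (removeAt x j) (a * s)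
        reduced = rightInverse⇒kernel N (λ i → removeAt (row i) j) (λ l → removeAt (B (suc l)) j)
          (a * s) (removeAt x j)
          (λ i → dot-row≈ i (B (suc i)) (diag (suc i)) (off zero (suc i) λ ()))
          (λ i l i≢l → trans (dot-row≈ i (B (suc l)) (off (suc i) (suc l) λ eq → i≢l (Finₚ.suc-injective eq))
                         (off zero (suc l) λ ())) (zeroʳ a))
          (λ i → trans (dot-row≈ i x (Ax≈0 (suc i)) (Ax≈0 zero)) (zeroʳ a))

        e = (a * s) ^′ proj₁ reduced

        clear-pivot : e * (a * x j) ≈ 0#
        clear-pivot = begin
          e * (a * x j)                     ≈⟨ +-identityʳ _ ⟨
          e * (a * x j) + 0#                ≈⟨ +-congˡ (sum-zero (λ q →
                                                 trans (solve 3 (λ e u x → e :* (u :* x) := u :* (e :* x)) refl _ _ _)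
                                                   (trans (*-congˡ (proj₂ reduced q)) (zeroʳ _)))) ⟨
          e * (a * x j) + sum (λ q → e * (removeAt (A zero) j q * removeAt x j q))
                                            ≈⟨ +-congˡ (*-distribˡ-sum e (λ q → removeAt (A zero) j q * removeAt x j q)) ⟨
          e * (a * x j) + e * dot (removeAt (A zero) j) (removeAt x j)
                                            ≈⟨ distribˡ e _ _ ⟨
          e * (a * x j + dot (removeAt (A zero) j) (removeAt x j))
                                            ≈⟨ *-congˡ (sum-remove {i = j} (λ q → A zero q * x q)) ⟨
          e * dot (A zero) x                ≈⟨ *-congˡ (Ax≈0 zero) ⟩
          e * 0#                            ≈⟨ zeroʳ e ⟩
          0#                                ∎

        clear : ∀ q → (a * s) * e * x q ≈ 0#
        clear = punchIn-cases j
          (begin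
            (a * s) * e * x j    ≈⟨ solve 4 (λ a s e x → (a :* s) :* e :* x := s :* (e :* (a :* x)))
                                      refl a s e (x j) ⟩
            s * (e * (a * x j))  ≈⟨ *-congˡ clear-pivot ⟩
            s * 0#               ≈⟨ zeroʳ s ⟩
            0#                   ∎)
          (λ q → trans (*-assoc (a * s) e _) (trans (*-congˡ (proj₂ reduced q)) (zeroʳ _)))

    1^k*x≈x : ∀ k x → 1# ^′ k * x ≈ x
    1^k*x≈x zero x = *-identityˡ x
    1^k*x≈x (suc k) x = trans (*-congʳ (*-identityˡ _)) (1^k*x≈x k x)

    basis : ∀ {N} → Fin N → Fin N → Carrier
    basis i j = if does (i Data.Fin.≟ j) then 1# else 0#

    basis-diag : ∀ {N} (i : Fin N) → basis i i ≈ 1#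
    basis-diag i with i Data.Fin.≟ i
    ... | yes _ = refl
    ... | no i≢i = ⊥-elim (i≢i ≡.refl)

    basis-off : ∀ {N} {i j : Fin N} → ¬ (i ≡ j) → basis i j ≈ 0#
    basis-off {i = i} {j} i≢j with i Data.Fin.≟ j
    ... | yes i≡j = ⊥-elim (i≢j i≡j)
    ... | no _ = refl

    basis-expansion : ∀ {N} (v : Fin N → Carrier) i → sum (λ j → v j * basis j i) ≈ v i
    basis-expansion v i = trans
      (sum-single i (λ j i≢j → trans (*-congˡ (basis-off (λ j≡i → i≢j (≡.sym j≡i)))) (zeroʳ _)))
      (trans (*-congˡ (basis-diag i)) (*-identityʳ _))

    record IsLinearForm {N} (T : (Fin N → Carrier) → Carrier) : Set (c ⊔ ℓ) where
      field
        form-cong : ∀ {v w} → (∀ i → v i ≈ w i) → T v ≈ T w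
        form-+ : ∀ v w → T (λ i → v i + w i) ≈ T v + T w
        form-* : ∀ a v → T (λ i → a * v i) ≈ a * T v

      form-sum : ∀ m (a : Fin m → Carrier) (w : Fin m → Fin N → Carrier) →
        T (λ i → sum (λ j → a j * w j i)) ≈ sum (λ j → a j * T (w j))
      form-sum zero a w = trans (form-cong (λ i → sym (zeroˡ 0#)))
        (trans (form-* 0# (λ _ → 0#)) (zeroˡ _))
      form-sum (suc m) a w = trans (form-+ _ _)
        (+-cong (form-* (a zero) (w zero)) (form-sum m (a ∘ suc) (w ∘ suc)))

      form≈dot : ∀ v → T v ≈ dot v (λ j → T (basis j))
      form≈dot v = trans (form-cong (λ i → sym (basis-expansion v i))) (form-sum N v basis)

    -- The vectors `S (basis l)` are the columns of a right inverse of the matrix of `T`; `S` itself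
    -- may be any function. With s = 1, the radical of the annihilator of `v` contains 1, and powers
    -- of 1 act as the identity.
    surjective⇒injective : ∀ {N} {T S : (Fin N → Carrier) → Fin N → Carrier} →
      (∀ i → IsLinearForm (λ v → T v i)) → (∀ v i → T (S v) i ≈ v i) →
      ∀ v → (∀ i → T v i ≈ 0#) → ∀ i → v i ≈ 0#
    surjective⇒injective {N} {T} {S} T-linear TS v Tv≈0 i =
      trans (sym (1^k*x≈x (proj₁ killed) (v i))) (proj₂ killed i)
      where
      A : Fin N → Fin N → Carrier
      A i j = T (basis j) i

      dot-A : ∀ i w → dot (A i) w ≈ T w i
      dot-A i w = trans (sum-cong-≋ (λ j → *-comm (A i j) (w j)))
        (sym (IsLinearForm.form≈dot (T-linear i) w))

      killed : RadAnn v 1#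
      killed = rightInverse⇒kernel N A (λ l → S (basis l)) 1# v
        (λ i → trans (dot-A i _) (trans (TS (basis i) i) (basis-diag i)))
        (λ i l i≢l → trans (dot-A i _) (trans (TS (basis l) i) (basis-off (λ l≡i → i≢l (≡.sym l≡i)))))
        (λ i → trans (dot-A i v) (Tv≈0 i))

    sumPoly : ∀ {V} m → (Fin m → Poly R V) → Poly R V
    sumPoly zero p = con 0#
    sumPoly (suc m) p = p zero ⊕ sumPoly m (p ∘ suc)

    evalPoly-sumPoly : ∀ {V} m (p : Fin m → Poly R V) ρ →
      evalPoly R (sumPoly m p) ρ ≈ sum (λ i → evalPoly R (p i) ρ)
    evalPoly-sumPoly zero p ρ = refl
    evalPoly-sumPoly (suc m) p ρ = +-congˡ (evalPoly-sumPoly m (p ∘ suc) ρ)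

  -- The incidence algebra: its zero, unit and product.

  module _ (n : ℕ) (_≤ₚ_ : Rel (Fin n) Level.zero) (isPartialOrder : IsPartialOrder _≡_ _≤ₚ_)
           (_≤?_ : Decidable _≤ₚ_) where
    open Incidence R n _≤ₚ_ _≤?_
    private module P = IsPartialOrder isPartialOrder

    0ᴵ : Fun
    0ᴵ x y = 0#

    InI-0ᴵ : InI 0ᴵ
    InI-0ᴵ x y x≰y = refl

    InI-·ᴵ : ∀ a {f} → InI f → InI (a ·ᴵ f)
    InI-·ᴵ a f∈I x y x≰y = trans (*-congˡ (f∈I x y x≰y)) (zeroʳ a)

    InI-+ᴵ : ∀ {f g} → InI f → InI g → InI (f +ᴵ g)
    InI-+ᴵ f∈I g∈I x y x≰y = trans (+-cong (f∈I x y x≰y) (g∈I x y x≰y)) (+-identityʳ 0#)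

    InI-δ : InI δ
    InI-δ x y x≰y with x Data.Fin.≟ y
    ... | yes ≡.refl = ⊥-elim (x≰y P.refl)
    ... | no _ = refl

    ≋-sym : ∀ {f g} → f ≋ g → g ≋ f
    ≋-sym f≋g x y = sym (f≋g x y)

    ≋-trans : ∀ {f g h} → f ≋ g → g ≋ h → f ≋ h
    ≋-trans f≋g g≋h x y = trans (f≋g x y) (g≋h x y)

    term-cong : ∀ {f f′ g g′} → f ≋ f′ → g ≋ g′ → ∀ x y z → term f g x y z ≈ term f′ g′ x y z
    term-cong f≋f′ g≋g′ x y z with x ≤? z | z ≤? y
    ... | yes _ | yes _ = *-cong (f≋f′ x z) (g≋g′ z y)
    ... | yes _ | no _ = refl
    ... | no _ | yes _ = refl
    ... | no _ | no _ = refl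

    *ᴵ-cong : ∀ {f f′ g g′} → f ≋ f′ → g ≋ g′ → (f *ᴵ g) ≋ (f′ *ᴵ g′)
    *ᴵ-cong f≋f′ g≋g′ x y = sumFin-cong n (term-cong f≋f′ g≋g′ x y)

    *ᴵ-zeroʳ : ∀ f → (f *ᴵ 0ᴵ) ≋ 0ᴵ
    *ᴵ-zeroʳ f x y = sumFin-zero n term≈0
      where
      term≈0 : ∀ z → term f 0ᴵ x y z ≈ 0#
      term≈0 z with x ≤? z | z ≤? y
      ... | yes _ | yes _ = zeroʳ _
      ... | yes _ | no _ = refl
      ... | no _ | yes _ = refl
      ... | no _ | no _ = refl

    δ-diag : ∀ x → δ x x ≈ 1#
    δ-diag x with x Data.Fin.≟ x
    ... | yes _ = refl
    ... | no x≢x = ⊥-elim (x≢x ≡.refl)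

    δ-off : ∀ {x y} → ¬ (x ≡ y) → δ x y ≈ 0#
    δ-off {x} {y} x≢y with x Data.Fin.≟ y
    ... | yes x≡y = ⊥-elim (x≢y x≡y)
    ... | no _ = refl

    -- Scaling is expressed through the product, which makes it visible to a map known only to be
    -- multiplicative.
    ·δ-*ᴵ : ∀ t {f} → InI f → ((t ·ᴵ δ) *ᴵ f) ≋ (t ·ᴵ f)
    ·δ-*ᴵ t {f} f∈I x y = trans (sumFin-single n x off) diag
      where
      off : ∀ z → ¬ (x ≡ z) → term (t ·ᴵ δ) f x y z ≈ 0#
      off z x≢z with x ≤? z | z ≤? y
      ... | yes _ | yes _ = trans (*-congʳ (trans (*-congˡ (δ-off x≢z)) (zeroʳ t))) (zeroˡ _)
      ... | yes _ | no _ = refl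
      ... | no _ | yes _ = refl
      ... | no _ | no _ = refl

      diag : term (t ·ᴵ δ) f x y x ≈ t * f x y
      diag with x ≤? x | x ≤? y
      ... | yes _ | yes _ = *-congʳ (trans (*-congˡ (δ-diag x)) (*-identityʳ t))
      ... | yes _ | no x≰y = sym (InI-·ᴵ t f∈I x y x≰y)
      ... | no x≰x | _ = ⊥-elim (x≰x P.refl)

    *ᴵ-δ : ∀ {f} → InI f → (f *ᴵ δ) ≋ f
    *ᴵ-δ {f} f∈I x y = trans (sumFin-single n y off) diag
      where
      off : ∀ z → ¬ (y ≡ z) → term f δ x y z ≈ 0#
      off z y≢z with x ≤? z | z ≤? y
      ... | yes _ | yes _ = trans (*-congˡ (δ-off (λ z≡y → y≢z (≡.sym z≡y)))) (zeroʳ _)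
      ... | yes _ | no _ = refl
      ... | no _ | yes _ = refl
      ... | no _ | no _ = refl

      diag : term f δ x y y ≈ f x y
      diag with x ≤? y | y ≤? y
      ... | yes _ | yes _ = trans (*-congˡ (δ-diag y)) (*-identityʳ _)
      ... | no x≰y | yes _ = sym (f∈I x y x≰y)
      ... | yes _ | no y≰y = ⊥-elim (y≰y P.refl)
      ... | no _ | no y≰y = ⊥-elim (y≰y P.refl)

    *ᴵ-zeroˡ : ∀ f → (0ᴵ *ᴵ f) ≋ 0ᴵ
    *ᴵ-zeroˡ f x y = sumFin-zero n term≈0
      where
      term≈0 : ∀ z → term 0ᴵ f x y z ≈ 0#
      term≈0 z with x ≤? z | z ≤? y
      ... | yes _ | yes _ = zeroˡ _
      ... | yes _ | no _ = refl
      ... | no _ | yes _ = refl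
      ... | no _ | no _ = refl

    InI-*ᴵ : ∀ {f g} → InI f → InI g → InI (f *ᴵ g)
    InI-*ᴵ {f} {g} _ _ x y x≰y = sumFin-zero n term≈0
      where
      term≈0 : ∀ z → term f g x y z ≈ 0#
      term≈0 z with x ≤? z | z ≤? y
      ... | yes x≤z | yes z≤y = ⊥-elim (x≰y (P.trans x≤z z≤y))
      ... | yes _ | no _ = refl
      ... | no _ | yes _ = refl
      ... | no _ | no _ = refl

    δ-*ᴵ : ∀ {f} → InI f → (δ *ᴵ f) ≋ f
    δ-*ᴵ f∈I = ≋-trans (*ᴵ-cong (λ x y → sym (*-identityˡ _)) (λ _ _ → refl))
      (≋-trans (·δ-*ᴵ 1# f∈I) (λ x y → *-identityˡ _))

    -- Jets of curves in I(P) and differentials of morphisms.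

    HasJetᴵ : (Carrier → Fun) → Fun → Fun → Set (c ⊔ ℓ)
    HasJetᴵ F A B = ∀ x y → HasJet (λ t → F t x y) (A x y) (B x y)

    jet-*ᴵʳ : ∀ {F A B} g → HasJetᴵ F A B → HasJetᴵ (λ t → F t *ᴵ g) (A *ᴵ g) (B *ᴵ g)
    jet-*ᴵʳ {F} {A} {B} g jet x y = jet-sumFin n jet-term
      where
      jet-term : ∀ z → HasJet (λ t → term (F t) g x y z) (term A g x y z) (term B g x y z)
      jet-term z with x ≤? z | z ≤? y
      ... | yes _ | yes _ = jet-*ʳ (g z y) (jet x z)
      ... | yes _ | no _ = jet-const 0#
      ... | no _ | yes _ = jet-const 0#
      ... | no _ | no _ = jet-const 0#

    jet-*ᴵˡ : ∀ {F A B} g → HasJetᴵ F A B → HasJetᴵ (λ t → g *ᴵ F t) (g *ᴵ A) (g *ᴵ B)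
    jet-*ᴵˡ {F} {A} {B} g jet x y = jet-sumFin n jet-term
      where
      jet-term : ∀ z → HasJet (λ t → term g (F t) x y z) (term g A x y z) (term g B x y z)
      jet-term z with x ≤? z | z ≤? y
      ... | yes _ | yes _ = jet-*ˡ (g x z) (jet z y)
      ... | yes _ | no _ = jet-const 0#
      ... | no _ | yes _ = jet-const 0#
      ... | no _ | no _ = jet-const 0#

    jet-·ᴵ : ∀ f → HasJetᴵ (λ t → t ·ᴵ f) 0ᴵ f
    jet-·ᴵ f x y = jet-line (f x y)

    morphism-cong : ∀ {φ} → IsMorphism φ → ∀ {f g} → InI f → InI g → f ≋ g → φ f ≋ φ g
    morphism-cong (_ , p , φ≈) {f} {g} f∈I g∈I f≋g x y = begin
      _ ≈⟨ φ≈ f f∈I x y ⟩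
      _ ≈⟨ evalPoly-cong (p x y) (λ (u , v) → f≋g u v) ⟩
      _ ≈⟨ φ≈ g g∈I x y ⟨
      _ ∎

    -- The differential of a morphism at 0.
    linearPart : ∀ {φ} → IsMorphism φ → Fun → Fun
    linearPart (_ , p , _) f x y = deriv (p x y) (λ _ → 0#) (λ (u , v) → f u v)

    linearPart-+ : ∀ {φ} (mor : IsMorphism φ) f g →
      linearPart mor (f +ᴵ g) ≋ (linearPart mor f +ᴵ linearPart mor g)
    linearPart-+ (_ , p , _) f g x y = deriv-+ (p x y) _ _ _

    linearPart-· : ∀ {φ} (mor : IsMorphism φ) a f →
      linearPart mor (a ·ᴵ f) ≋ (a ·ᴵ linearPart mor f)
    linearPart-· (_ , p , _) a f x y = deriv-* (p x y) _ a _

    -- The curve must stay in I(P), since only there is `φ` given by its polynomials. That it need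
    -- not be a line permits iteration, as in `linearPart-leftInverse`.
    jet-morphism : ∀ {φ} (mor : IsMorphism φ) → φ 0ᴵ ≋ 0ᴵ →
      ∀ {F B} → (∀ t → InI (F t)) → HasJetᴵ F 0ᴵ B → HasJetᴵ (λ t → φ (F t)) 0ᴵ (linearPart mor B)
    jet-morphism (_ , p , φ≈) φ0≋0 F∈I jet x y =
      jet-cong (λ t → sym (φ≈ _ (F∈I t) x y))
        (trans (sym (φ≈ 0ᴵ InI-0ᴵ x y)) (φ0≋0 x y)) refl
        (jet-evalPoly (p x y) (λ (u , v) → jet u v))

    -- Semigroup automorphisms are linear.

    module _ (algClosed : IsAlgClosed R) where

      -- For x ≰ y the polynomial `p x y` need not be the zero expression. Its values along the line
      -- t f are 0, and uniqueness of jets passes this on to the derivative.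
      linearPart-InI : ∀ {φ} (mor : IsMorphism φ) → φ 0ᴵ ≋ 0ᴵ → ∀ f → InI f → InI (linearPart mor f)
      linearPart-InI mor@(φ∈I , _) φ0≋0 f f∈I x y x≰y =
        jet-unique algClosed
          (jet-morphism mor φ0≋0 (λ t → InI-·ᴵ t f∈I) (jet-·ᴵ f) x y)
          (jet-cong (λ t → sym (φ∈I _ (InI-·ᴵ t f∈I) x y x≰y)) refl refl (jet-const 0#))

      -- The curve ψ(φ(t f)) = t f has two jets at 0: one from applying the chain rule twice, and
      -- the evident one.
      linearPart-leftInverse : ∀ {φ ψ} (φ-mor : IsMorphism φ) (ψ-mor : IsMorphism ψ) →
        φ 0ᴵ ≋ 0ᴵ → ψ 0ᴵ ≋ 0ᴵ → (∀ f → InI f → ψ (φ f) ≋ f) →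
        ∀ f → InI f → linearPart ψ-mor (linearPart φ-mor f) ≋ f
      linearPart-leftInverse φ-mor@(φ∈I , _) ψ-mor φ0≋0 ψ0≋0 ψφ f f∈I x y =
        jet-unique algClosed
          (jet-morphism ψ-mor ψ0≋0 (λ t → φ∈I _ (InI-·ᴵ t f∈I))
            (jet-morphism φ-mor φ0≋0 (λ t → InI-·ᴵ t f∈I) (jet-·ᴵ f)) x y)
          (jet-cong (λ t → sym (ψφ _ (InI-·ᴵ t f∈I) x y)) refl refl (jet-·ᴵ f x y))

      module _ {φ : Fun → Fun} (mor : IsMorphism φ) (φ0≋0 : φ 0ᴵ ≋ 0ᴵ)
               (φ-* : ∀ f g → InI f → InI g → φ (f *ᴵ g) ≋ (φ f *ᴵ φ g)) where
        private
          L = linearPart mor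
          φ∈I = proj₁ mor

        jet-φ· : ∀ {f} → InI f → HasJetᴵ (λ t → φ (t ·ᴵ f)) 0ᴵ (L f)
        jet-φ· {f} f∈I = jet-morphism mor φ0≋0 (λ t → InI-·ᴵ t f∈I) (jet-·ᴵ f)

        φ·-factor : ∀ t {f} → InI f → φ (t ·ᴵ f) ≋ (φ (t ·ᴵ δ) *ᴵ φ f)
        φ·-factor t {f} f∈I = ≋-trans
          (morphism-cong mor (InI-·ᴵ t f∈I) (InI-*ᴵ (InI-·ᴵ t InI-δ) f∈I) (≋-sym (·δ-*ᴵ t f∈I)))
          (φ-* _ f (InI-·ᴵ t InI-δ) f∈I)

        linearPart≋Lδ* : ∀ {f} → InI f → L f ≋ (L δ *ᴵ φ f)
        linearPart≋Lδ* {f} f∈I x y = jet-unique algClosed (jet-φ· f∈I x y)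
          (jet-cong (λ t → sym (φ·-factor t f∈I x y)) refl refl
            (jet-*ᴵʳ (φ f) (jet-φ· InI-δ) x y))

        -- By linearity and `linearPart≋Lδ*` at t f, t L f = L(t f) = L δ · φ(t f). The coefficients
        -- of t on the two sides are L f and L δ · L f.
        Lδ*linearPart : ∀ {f} → InI f → (L δ *ᴵ L f) ≋ L f
        Lδ*linearPart {f} f∈I x y = jet-unique algClosed
          (jet-*ᴵˡ (L δ) (jet-φ· f∈I) x y)
          (jet-cong (λ t → trans (sym (linearPart-· mor t f x y)) (linearPart≋Lδ* (InI-·ᴵ t f∈I) x y))
            refl refl (jet-·ᴵ (L f) x y))

        -- L δ acts as the identity on the image of L, which is everything.
        φ≋linearPart : (M : Fun → Fun) → (∀ g → InI g → InI (M g)) → (∀ g → InI g → L (M g) ≋ g) →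
          ∀ f → InI f → φ f ≋ L f
        φ≋linearPart M M∈I LM f f∈I = ≋-trans (≋-sym Lδ*φf≋φf) (≋-sym (linearPart≋Lδ* f∈I))
          where
          φf∈I = φ∈I f f∈I
          Lδ*φf≋φf : (L δ *ᴵ φ f) ≋ φ f
          Lδ*φf≋φf = ≋-trans (*ᴵ-cong (λ _ _ → refl) (≋-sym (LM _ φf∈I)))
            (≋-trans (Lδ*linearPart (M∈I _ φf∈I)) (LM _ φf∈I))

      module _ {φ ψ : Fun → Fun} (mor : IsMorphism φ) (ψ-mor : IsMorphism ψ)
               (ψφ : ∀ f → InI f → ψ (φ f) ≋ f) (φψ : ∀ f → InI f → φ (ψ f) ≋ f)
               (φ-* : ∀ f g → InI f → InI g → φ (f *ᴵ g) ≋ (φ f *ᴵ φ g)) where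
        private
          φ∈I = proj₁ mor
          ψ∈I = proj₁ ψ-mor
          φ-cong = morphism-cong mor

        -- Zero is absorbing and is attained: φ(0) = φ(0 · ψ(0)) = φ(0) · φ(ψ(0)) = φ(0) · 0 = 0.
        φ-zero : φ 0ᴵ ≋ 0ᴵ
        φ-zero = ≋-trans (φ-cong InI-0ᴵ (InI-*ᴵ InI-0ᴵ z∈I) (≋-sym (*ᴵ-zeroˡ _)))
          (≋-trans (φ-* 0ᴵ (ψ 0ᴵ) InI-0ᴵ z∈I)
            (≋-trans (*ᴵ-cong (λ _ _ → refl) (φψ 0ᴵ InI-0ᴵ)) (*ᴵ-zeroʳ _)))
          where z∈I = ψ∈I 0ᴵ InI-0ᴵ

        ψ-zero : ψ 0ᴵ ≋ 0ᴵ
        ψ-zero = ≋-trans (morphism-cong ψ-mor InI-0ᴵ (φ∈I 0ᴵ InI-0ᴵ) (≋-sym φ-zero)) (ψφ 0ᴵ InI-0ᴵ)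

        -- φ(δ) is a left identity on the image of φ, which contains δ: φ(δ) = φ(δ) · φ(ψ(δ)) = φ(δ
        -- · ψ(δ)) = δ.
        φ-δ : φ δ ≋ δ
        φ-δ = ≋-trans (≋-sym (*ᴵ-δ (φ∈I δ InI-δ)))
          (≋-trans (*ᴵ-cong (λ _ _ → refl) (≋-sym (φψ δ InI-δ)))
          (≋-trans (≋-sym (φ-* δ (ψ δ) InI-δ u∈I))
          (≋-trans (φ-cong (InI-*ᴵ InI-δ u∈I) u∈I (δ-*ᴵ u∈I)) (φψ δ InI-δ))))
          where u∈I = ψ∈I δ InI-δ

        φ-linear : ∀ f → InI f → φ f ≋ linearPart mor f
        -- A right inverse of the differential of `φ` is required, so the chain rule is applied to φ
        -- ψ = id, with the roles of `φ` and `ψ` exchanged.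
        φ-linear = φ≋linearPart mor φ-zero φ-* (linearPart ψ-mor)
          (linearPart-InI ψ-mor ψ-zero)
          (linearPart-leftInverse ψ-mor mor ψ-zero φ-zero φψ)

      isSGAut⇒isAlgAut : ∀ {φ} → IsSGAut φ → IsAlgAut φ
      isSGAut⇒isAlgAut (mor@(φ∈I , _) , (ψ , ψ-mor , ψ-inv@(_ , ψφ , φψ)) , φ-*) =
        φ∈I , (λ _ _ → morphism-cong mor) , (ψ , ψ-inv) ,
        (λ f g f∈I g∈I x y → begin
          _ ≈⟨ linear _ (InI-+ᴵ f∈I g∈I) x y ⟩
          _ ≈⟨ linearPart-+ mor f g x y ⟩
          _ ≈⟨ +-cong (linear f f∈I x y) (linear g g∈I x y) ⟨
          _ ∎) ,
        (λ a f f∈I x y → begin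
          _ ≈⟨ linear _ (InI-·ᴵ a f∈I) x y ⟩
          _ ≈⟨ linearPart-· mor a f x y ⟩
          _ ≈⟨ *-congˡ (linear f f∈I x y) ⟨
          _ ∎) ,
        φ-* , φ-δ mor ψ-mor ψφ φψ φ-*
        where linear = φ-linear mor ψ-mor ψφ φψ φ-*

    -- The splitting of all functions into I(P) and a complement, and coordinates by vectors of
    -- length n².

    projI : Fun → Fun
    projI f x y = if does (x ≤? y) then f x y else 0#

    projI⊥ : Fun → Fun
    projI⊥ f x y = if does (x ≤? y) then 0# else f x y

    InI-projI : ∀ f → InI (projI f)
    InI-projI f x y x≰y with x ≤? y
    ... | yes x≤y = ⊥-elim (x≰y x≤y)
    ... | no _ = refl

    projI-fixes : ∀ {f} → InI f → projI f ≋ f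
    projI-fixes f∈I x y with x ≤? y
    ... | yes _ = refl
    ... | no x≰y = sym (f∈I x y x≰y)

    projI-cong : ∀ {f g} → f ≋ g → projI f ≋ projI g
    projI-cong f≋g x y with x ≤? y
    ... | yes _ = f≋g x y
    ... | no _ = refl

    projI-+ : ∀ f g → projI (f +ᴵ g) ≋ (projI f +ᴵ projI g)
    projI-+ f g x y with x ≤? y
    ... | yes _ = refl
    ... | no _ = sym (+-identityʳ 0#)

    projI-· : ∀ a f → projI (a ·ᴵ f) ≋ (a ·ᴵ projI f)
    projI-· a f x y with x ≤? y
    ... | yes _ = refl
    ... | no _ = sym (zeroʳ a)

    projI⊥-cong : ∀ {f g} → f ≋ g → projI⊥ f ≋ projI⊥ g
    projI⊥-cong f≋g x y with x ≤? y
    ... | yes _ = refl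
    ... | no _ = f≋g x y

    projI⊥-+ : ∀ f g → projI⊥ (f +ᴵ g) ≋ (projI⊥ f +ᴵ projI⊥ g)
    projI⊥-+ f g x y with x ≤? y
    ... | yes _ = sym (+-identityʳ 0#)
    ... | no _ = refl

    projI⊥-· : ∀ a f → projI⊥ (a ·ᴵ f) ≋ (a ·ᴵ projI⊥ f)
    projI⊥-· a f x y with x ≤? y
    ... | yes _ = sym (zeroʳ a)
    ... | no _ = refl

    projI+projI⊥ : ∀ f → (projI f +ᴵ projI⊥ f) ≋ f
    projI+projI⊥ f x y with x ≤? y
    ... | yes _ = +-identityʳ _
    ... | no _ = +-identityˡ _

    projI-split : ∀ {g} → InI g → ∀ f → projI (g +ᴵ projI⊥ f) ≋ g
    projI-split g∈I f x y with x ≤? y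
    ... | yes _ = +-identityʳ _
    ... | no x≰y = sym (g∈I x y x≰y)

    projI⊥-split : ∀ {g} → InI g → ∀ f → projI⊥ (g +ᴵ projI⊥ f) ≋ projI⊥ f
    projI⊥-split g∈I f x y with x ≤? y
    ... | yes _ = refl
    ... | no x≰y = trans (+-congʳ (g∈I x y x≰y)) (+-identityˡ _)

    toFun : (Fin (n ℕ.* n) → Carrier) → Fun
    toFun v x y = v (combine x y)

    index : Fin (n ℕ.* n) → Fin n × Fin n
    index = remQuot n

    toVec : Fun → Fin (n ℕ.* n) → Carrier
    toVec f i = f (proj₁ (index i)) (proj₂ (index i))

    toFun-toVec : ∀ f → toFun (toVec f) ≋ f
    toFun-toVec f x y = reflexive
      (≡.cong (λ p → f (proj₁ p) (proj₂ p)) (Finₚ.remQuot-combine {n} x y))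

    toVec-toFun : ∀ v i → toVec (toFun v) i ≈ v i
    toVec-toFun v i = reflexive (≡.cong v (Finₚ.combine-remQuot {n} n i))

    -- Linear maps on I(P) are morphisms, and algebra automorphisms are semigroup automorphisms.

    record IsLinearOnI (φ : Fun → Fun) : Set (c ⊔ ℓ) where
      field
        mapsInto : MapsInto φ
        congᴵ : ∀ f g → InI f → InI g → f ≋ g → φ f ≋ φ g
        additive : ∀ f g → InI f → InI g → φ (f +ᴵ g) ≋ (φ f +ᴵ φ g)
        homogeneous : ∀ a f → InI f → φ (a ·ᴵ f) ≋ (a ·ᴵ φ f)

      φ∘projI-cong : ∀ {f g} → f ≋ g → φ (projI f) ≋ φ (projI g)
      φ∘projI-cong f≋g = congᴵ _ _ (InI-projI _) (InI-projI _) (projI-cong f≋g)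

      φ∘projI-+ : ∀ f g → φ (projI (f +ᴵ g)) ≋ (φ (projI f) +ᴵ φ (projI g))
      φ∘projI-+ f g = ≋-trans
        (congᴵ _ _ (InI-projI _) (InI-+ᴵ (InI-projI f) (InI-projI g)) (projI-+ f g))
        (additive _ _ (InI-projI f) (InI-projI g))

      φ∘projI-· : ∀ a f → φ (projI (a ·ᴵ f)) ≋ (a ·ᴵ φ (projI f))
      φ∘projI-· a f = ≋-trans
        (congᴵ _ _ (InI-projI _) (InI-·ᴵ a (InI-projI f)) (projI-· a f))
        (homogeneous a _ (InI-projI f))

      coordinate-linear : ∀ x y → IsLinearForm (λ v → φ (projI (toFun v)) x y)
      coordinate-linear x y = record
        { form-cong = λ v≈w → φ∘projI-cong (λ u v → v≈w (combine u v)) x y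
        ; form-+ = λ v w → φ∘projI-+ (toFun v) (toFun w) x y
        ; form-* = λ a v → φ∘projI-· a (toFun v) x y
        }

      isMorphism : IsMorphism φ
      isMorphism = mapsInto , poly , φ≈
        where
        poly : Fin n → Fin n → Poly R (Fin n × Fin n)
        -- A basis function lies outside I(P) when its pair is not in the order relation. `projI`
        -- then replaces it by zero, so `φ` is evaluated only on I(P).
        poly x y = sumPoly (n ℕ.* n) λ i → var (index i) ⊗ con (φ (projI (toFun (basis i))) x y)

        φ≈ : ∀ f → InI f → ∀ x y → φ f x y ≈ evalPoly R (poly x y) (λ { (u , v) → f u v })
        φ≈ f f∈I x y = begin
          φ f x y
            ≈⟨ congᴵ _ _ (InI-projI _) f∈I (≋-trans (projI-cong (toFun-toVec f)) (projI-fixes f∈I)) x y ⟨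
          φ (projI (toFun (toVec f))) x y
            ≈⟨ IsLinearForm.form≈dot (coordinate-linear x y) (toVec f) ⟩
          dot (toVec f) (λ i → φ (projI (toFun (basis i))) x y)
            ≈⟨ evalPoly-sumPoly (n ℕ.* n) _ _ ⟨
          evalPoly R (poly x y) (λ (u , v) → f u v) ∎

      -- φ is extended to the free module of all functions by the identity on the complement of I(P).
      kernel-trivial : ∀ {ψ} → MapsInto ψ → (∀ f → InI f → φ (ψ f) ≋ f) →
        ∀ f → InI f → φ f ≋ 0ᴵ → f ≋ 0ᴵ
      kernel-trivial {ψ} ψ∈I φψ f f∈I φf≋0 x y = trans (sym (toFun-toVec f x y))
        (surjective⇒injective {T = T} {S = S} T-linear TS (toVec f) Tf≈0 (combine x y))
        where
        extend : (Fun → Fun) → Fun → Fun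
        extend χ g = χ (projI g) +ᴵ projI⊥ g

        T S : (Fin (n ℕ.* n) → Carrier) → Fin (n ℕ.* n) → Carrier
        T v = toVec (extend φ (toFun v))
        S v = toVec (extend ψ (toFun v))

        extend-cong : ∀ {g h} → g ≋ h → extend φ g ≋ extend φ h
        extend-cong g≋h u v = +-cong (φ∘projI-cong g≋h u v) (projI⊥-cong g≋h u v)

        T-linear : ∀ i → IsLinearForm (λ v → T v i)
        T-linear i = record
          { form-cong = λ v≈w → extend-cong (λ u v → v≈w (combine u v)) _ _
          ; form-+ = λ v w → trans
              (+-cong (φ∘projI-+ (toFun v) (toFun w) _ _) (projI⊥-+ (toFun v) (toFun w) _ _))
              (solve 4 (λ a b a′ b′ → (a :+ b) :+ (a′ :+ b′) := (a :+ a′) :+ (b :+ b′)) refl _ _ _ _)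
          ; form-* = λ a v → trans
              (+-cong (φ∘projI-· a (toFun v) _ _) (projI⊥-· a (toFun v) _ _))
              (sym (distribˡ a _ _))
          }

        extend-inverse : ∀ g → extend φ (extend ψ g) ≋ g
        extend-inverse g = ≋-trans
          -- `extend ψ g` has component `ψ (projI g)` in I(P) and component `projI⊥ g` in the
          -- complement; `φ` undoes the first and the second is kept.
          (λ u v → +-cong
            (trans (congᴵ _ _ (InI-projI _) ψg∈I (projI-split ψg∈I g) u v) (φψ _ (InI-projI g) u v))
            (projI⊥-split ψg∈I g u v))
          (projI+projI⊥ g)
          where ψg∈I = ψ∈I _ (InI-projI g)

        TS : ∀ v i → T (S v) i ≈ v i
        TS v i = trans (extend-cong (toFun-toVec _) _ _)
          (trans (extend-inverse (toFun v) _ _) (toVec-toFun v i))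

        Tf≈0 : ∀ i → T (toVec f) i ≈ 0#
        Tf≈0 i = begin
          extend φ (toFun (toVec f)) _ _   ≈⟨ extend-cong (toFun-toVec f) _ _ ⟩
          extend φ f u v                   ≈⟨ +-cong (congᴵ _ _ (InI-projI f) f∈I (projI-fixes f∈I) u v)
                                                (sym (+-identityˡ _)) ⟩
          φ f u v + (0# + projI⊥ f u v)    ≈⟨ +-cong (φf≋0 u v) (trans (+-identityˡ _) (projI⊥-InI u v)) ⟩
          0# + 0#                          ≈⟨ +-identityʳ 0# ⟩
          0#                               ∎
          where
          u = proj₁ (index i)
          v = proj₂ (index i)

          projI⊥-InI : ∀ x y → projI⊥ f x y ≈ 0#
          projI⊥-InI x y with x ≤? y
          ... | yes _ = refl
          ... | no x≰y = f∈I x y x≰y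

      injectiveᴵ : ∀ {ψ} → MapsInto ψ → (∀ f → InI f → φ (ψ f) ≋ f) →
        ∀ f g → InI f → InI g → φ f ≋ φ g → f ≋ g
      injectiveᴵ ψ∈I φψ f g f∈I g∈I φf≋φg x y =
        neg-cancel (kernel-trivial ψ∈I φψ _ (InI-+ᴵ f∈I -g∈I) φ[f-g]≋0 x y)
        where
        -g∈I = InI-·ᴵ (- 1#) g∈I

        φ[f-g]≋0 : φ (f +ᴵ ((- 1#) ·ᴵ g)) ≋ 0ᴵ
        φ[f-g]≋0 u v = begin
          φ (f +ᴵ ((- 1#) ·ᴵ g)) u v        ≈⟨ additive _ _ f∈I -g∈I u v ⟩
          φ f u v + φ ((- 1#) ·ᴵ g) u v     ≈⟨ +-cong (φf≋φg u v) (homogeneous _ _ g∈I u v) ⟩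
          φ g u v + - 1# * φ g u v          ≈⟨ +-comm _ _ ⟩
          - 1# * φ g u v + φ g u v          ≈⟨ neg+self _ ⟩
          0#                                ∎

      -- Each law for `ψ` becomes one for `φ` after applying `φ`, and `injectiveᴵ` cancels `φ`
      -- again. Cancelling by means of ψ φ = id would presuppose that `ψ` respects `≋`, which is
      -- itself among the claims.
      inverse-isLinear : ∀ {ψ} → MapsInto ψ → (∀ f → InI f → φ (ψ f) ≋ f) → IsLinearOnI ψ
      inverse-isLinear {ψ} ψ∈I φψ = record
        { mapsInto = ψ∈I
        ; congᴵ = λ f g f∈I g∈I f≋g → inj _ _ (ψ∈I f f∈I) (ψ∈I g g∈I)
            (≋-trans (φψ f f∈I) (≋-trans f≋g (≋-sym (φψ g g∈I))))
        ; additive = λ f g f∈I g∈I → inj _ _ (ψ∈I _ (InI-+ᴵ f∈I g∈I))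
            (InI-+ᴵ (ψ∈I f f∈I) (ψ∈I g g∈I)) λ x y → begin
              φ (ψ (f +ᴵ g)) x y            ≈⟨ φψ _ (InI-+ᴵ f∈I g∈I) x y ⟩
              f x y + g x y                 ≈⟨ +-cong (φψ f f∈I x y) (φψ g g∈I x y) ⟨
              φ (ψ f) x y + φ (ψ g) x y     ≈⟨ additive _ _ (ψ∈I f f∈I) (ψ∈I g g∈I) x y ⟨
              φ (ψ f +ᴵ ψ g) x y            ∎
        ; homogeneous = λ a f f∈I → inj _ _ (ψ∈I _ (InI-·ᴵ a f∈I)) (InI-·ᴵ a (ψ∈I f f∈I)) λ x y → begin
              φ (ψ (a ·ᴵ f)) x y            ≈⟨ φψ _ (InI-·ᴵ a f∈I) x y ⟩
              a * f x y                     ≈⟨ *-congˡ (φψ f f∈I x y) ⟨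
              a * φ (ψ f) x y               ≈⟨ homogeneous a _ (ψ∈I f f∈I) x y ⟨
              φ (a ·ᴵ ψ f) x y              ∎
        }
        where inj = injectiveᴵ ψ∈I φψ

    isAlgAut⇒isSGAut : ∀ {φ} → IsAlgAut φ → IsSGAut φ
    isAlgAut⇒isSGAut {φ} (φ∈I , φ-cong , (ψ , ψ-inv@(ψ∈I , _ , φψ)) , φ-+ , φ-· , φ-* , _) =
      IsLinearOnI.isMorphism linear ,
      (ψ , IsLinearOnI.isMorphism (IsLinearOnI.inverse-isLinear linear ψ∈I φψ) , ψ-inv) , φ-*
      where
      linear : IsLinearOnI φ
      linear = record { mapsInto = φ∈I ; congᴵ = φ-cong ; additive = φ-+ ; homogeneous = φ-· }

theorem1p1 : {c ℓ : Level} (R : CommutativeRing c ℓ) → IsField R → IsAlgClosed R →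
    (n : ℕ) (_≤ₚ_ : Rel (Fin n) Level.zero) → IsPartialOrder _≡_ _≤ₚ_ →
    (_≤?_ : Decidable _≤ₚ_) →
    (φ : Incidence.Fun R n _≤ₚ_ _≤?_ → Incidence.Fun R n _≤ₚ_ _≤?_) →
    ((Incidence.IsSGAut R n _≤ₚ_ _≤?_ φ → Incidence.IsAlgAut R n _≤ₚ_ _≤?_ φ) ×
    (Incidence.IsAlgAut R n _≤ₚ_ _≤?_ φ → Incidence.IsSGAut R n _≤ₚ_ _≤?_ φ))
theorem1p1 R _ algClosed n _≤ₚ_ isPartialOrder _≤?_ φ =
  isSGAut⇒isAlgAut R n _≤ₚ_ isPartialOrder _≤?_ algClosed ,
  isAlgAut⇒isSGAut R n _≤ₚ_ isPartialOrder _≤?_
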